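{- There exist sets $A,B\subseteq\Sigma^*$ such that $B\leq^p_{s\text{ - }li\text{ - }T}A$ and $B\not\leq^p_{lni\text{ - }T}A$.
   Context: $\Sigma=\{0,1\}$; $|x|$ is the length of $x$. A DPTM is a deterministic oracle Turing machine $M$ for which there is one polynomial $p$ such that, for every oracle $X\subseteq\Sigma^*$ and input $x$, $M^X(x)$ halts within $p(|x|)$ steps; $L(M^X)$ is the set of inputs accepted with oracle $X$. $B\leq^p_{s\text{ - }li\text{ - }T}A$ (respectively $B\leq^p_{lni\text{ - }T}A$): there is a DPTM $M$ with $L(M^A)=B$ such that for every input $x$, either $M^A(x)$ makes no oracle queries, or the sequence $q_1,\dots,q_k$ ($k\ge1$), in order, of its queries satisfies $|x|<|q_1|<|q_2|<\dots<|q_k|$ (respectively $|q_1|\ge|q_2|\ge\dots\ge|q_k|$). -}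

module Defs where

open import Data.Bool using (Bool; true; false; if_then_else_)
open import Data.Fin using (Fin)
open import Data.List using (List; []; _∷_; _++_; _ʳ++_; length; map)
open import Data.List.Relation.Unary.Linked using (Linked)
open import Data.Nat using (ℕ; zero; suc; _+_; _*_; _<_; _≥_)
open import Data.Product using (_×_; _,_; ∃-syntax; proj₁; proj₂)
open import Data.Vec as Vec using (Vec; _∷_; replicate; zipWith)
open import Relation.Binary.PropositionalEquality using (_≡_)

-- Σ = {0,1}, with false for 0 and true for 1.
Word : Set
Word = List Bool

-- A subset of Σ* is given by its characteristic function, so that an oracle
-- can answer queries.
Language : Set
Language = Word → Bool

-- The list a₀ ∷ a₁ ∷ … ∷ [] stands for a₀ + a₁ n + a₂ n² + ….
Polynomial : Set
Polynomial = List ℕ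

eval : Polynomial → ℕ → ℕ
eval []      n = 0
eval (a ∷ p) n = a + n * eval p n

data Symbol (m : ℕ) : Set where
  blank : Symbol m
  bit   : Bool → Symbol m
  aux   : Fin m → Symbol m

data Move : Set where
  left stay right : Move

-- A tape that is infinite to the right only.  The cells to the left of the
-- head are listed nearest first, and all cells beyond the end of `after` are
-- blank.
record Tape (m : ℕ) : Set where
  constructor tape
  field
    before : List (Symbol m)
    head   : Symbol m
    after  : List (Symbol m)

open Tape public

tapeOf : ∀ {m} → List (Symbol m) → Tape m
tapeOf []       = tape [] blank []
tapeOf (s ∷ ss) = tape [] s ss

-- A left move on the leftmost cell leaves the head where it is.
move : ∀ {m} → Move → Tape m → Tape m
move left  (tape []       s rs)       = tape [] s rs
move left  (tape (l ∷ ls) s rs)       = tape ls l (s ∷ rs)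
move stay  t                          = t
move right (tape ls       s [])       = tape (s ∷ ls) blank []
move right (tape ls       s (r ∷ rs)) = tape (s ∷ ls) r rs

act : ∀ {m} → Tape m → Symbol m × Move → Tape m
act t (s , d) = move d (record t { head = s })

leadingBits : ∀ {m} → List (Symbol m) → Word
leadingBits (bit b ∷ ss) = b ∷ leadingBits ss
leadingBits _            = []

-- The word on a tape: the longest string over {0,1} starting at its leftmost
-- cell, wherever the head is.
word : ∀ {m} → Tape m → Word
word (tape ls s rs) = leadingBits (ls ʳ++ (s ∷ rs))

data State (n : ℕ) : Set where
  ordinary            : Fin n → State n
  query accept reject : State n

-- Deterministic oracle Turing machines.  There are 2 + extraTapes read-write
-- tapes: tape 0 is the oracle tape, tape 1 initially holds the input, and all
-- tapes except tape 1 are initially blank.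
record OracleTM : Set where
  field
    states     : ℕ
    auxSymbols : ℕ
    extraTapes : ℕ

  tapes : ℕ
  tapes = 2 + extraTapes

  field
    start yes no : Fin states
    δ : Fin states → Vec (Symbol auxSymbols) tapes →
        State states × Vec (Symbol auxSymbols × Move) tapes

module Computation (M : OracleTM) where
  open OracleTM M

  record Config : Set where
    constructor config
    field
      state    : State states
      contents : Vec (Tape auxSymbols) tapes

  open Config public

  initial : Word → Config
  initial x = config (ordinary start)
    (tapeOf [] ∷ tapeOf (map bit x) ∷ replicate extraTapes (tapeOf []))

  queryWord : Config → Word
  queryWord c = word (Vec.head (contents c))

  -- A query takes one step and leaves all tapes, including the oracle tape,
  -- unchanged.  Halted configurations are repeated forever.
  step : Language → Config → Config
  step X c@(config (ordinary q) ts) =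
    let r = δ q (Vec.map head ts) in config (proj₁ r) (zipWith act ts (proj₂ r))
  step X c@(config query ts) =
    config (ordinary (if X (queryWord c) then yes else no)) ts
  step X c@(config accept ts) = c
  step X c@(config reject ts) = c

  run : Language → ℕ → Config → Config
  run X zero    c = c
  run X (suc t) c = run X t (step X c)

  asked : Config → List Word
  asked c@(config query _) = queryWord c ∷ []
  asked _                  = []

  -- The queries made during the first t steps, in order.
  queries : Language → ℕ → Config → List Word
  queries X zero    c = []
  queries X (suc t) c = asked c ++ queries X t (step X c)

data Halted {n : ℕ} : State n → Set where
  accepted : Halted accept
  rejected : Halted reject

isAccept : ∀ {n} → State n → Bool
isAccept accept = true
isAccept _      = false

record DPTM : Set where
  field
    machine : OracleTM
    bound   : Polynomial

  open OracleTM machine public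
  open Computation machine public

  finalState : Language → Word → State states
  finalState X x = state (run X (eval bound (length x)) (initial x))

  field
    halts : ∀ (X : Language) (x : Word) → Halted (finalState X x)

  -- L(M^X).
  language : Language → Language
  language X x = isAccept (finalState X x)

  -- All queries of M^X(x): by `halts`, none is made after the time bound.
  querySequence : Language → Word → List Word
  querySequence X x = queries X (eval bound (length x)) (initial x)

infix 4 _≤s-li-T_ _≤lni-T_

-- In both reductions, the condition on lengths holds trivially when M^A(x)
-- makes no queries, since lists of length at most one are always linked.

_≤s-li-T_ : Language → Language → Set
B ≤s-li-T A = ∃[ M ] let open DPTM M in
  (∀ x → language A x ≡ B x) ×
  (∀ x → Linked _<_ (length x ∷ map length (querySequence A x)))

_≤lni-T_ : Language → Language → Set
B ≤lni-T A = ∃[ M ] let open DPTM M in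
  (∀ x → language A x ≡ B x) ×
  (∀ x → Linked _≥_ (map length (querySequence A x)))

{-# OPTIONS --safe #-}
-- On input x of length n, the increasing machine asks x1, x1w₁, x1w₁w₂, …,
-- where wᵢ is the answer to its i-th query, and outputs the answer to its n-th
-- query z = x1w₁…wₙ₋₁.  A machine with non-increasing query lengths that asks z
-- must do so before it can ask any of the shorter words that reveal z, so one
-- of the 2ⁿ⁻¹ candidates for z is missed within polynomial time, and the oracle
-- at that z can be set against the machine's output.  The oracle A is the limit
-- of stages that treat all pairs (machine, polynomial) in turn at rapidly
-- growing lengths; only the run within the polynomial time bound matters, so
-- pairs that do not halt in time need not be excluded.
module Submission where

open import Defs
open import Data.Bool using (Bool; true; false; if_then_else_; not)
open import Data.Bool.Properties using (not-¬) renaming (_≟_ to _≟ᵇ_)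
open import Data.Fin using (Fin; toℕ; fromℕ<)
open import Data.Fin.Patterns using (0F; 1F; 2F)
open import Data.Fin.Properties using (1↔⊤; 2↔Bool; +↔⊎; *↔×; toℕ<n; fromℕ<-toℕ)
open import Data.List
  using (List; []; _∷_; _++_; _ʳ++_; length; map; drop; replicate; reverse)
open import Data.List.Extrema.Nat using (max; xs≤max; ⊥≤max)
open import Data.List.Membership.Propositional using (_∈_; _∉_)
open import Data.List.Membership.Propositional.Properties using (∈-map⁺)
open import Data.List.Properties
  using (≡-dec; length-map; length-replicate; length-reverse; ʳ++-defn; ʳ++-ʳ++; ++-assoc)
open import Data.List.Relation.Unary.All as All using (All; []; _∷_)
open import Data.List.Relation.Unary.All.Properties using () renaming (map⁻ to All-map⁻)
open import Data.List.Relation.Unary.AllPairs using (AllPairs; []; _∷_)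
open import Data.List.Relation.Unary.Any using (here; there)
open import Data.List.Relation.Unary.Linked using (Linked; [-]; _∷_)
open import Data.List.Relation.Unary.Linked.Properties using (Linked⇒AllPairs)
open import Data.Maybe as Maybe using (Maybe; just; nothing; _>>=_)
open import Data.Nat
open import Data.Nat.ListAction using (sum)
open import Data.Nat.Properties
open import Data.Nat.Tactic.RingSolver using (solve-∀)
open import Data.Product using (Σ; _×_; _,_; ∃-syntax; proj₁; proj₂)
open import Data.Product.Function.NonDependent.Propositional using (_×-↔_)
open import Data.Sum using (_⊎_; inj₁; inj₂)
open import Data.Sum.Function.Propositional using (_⊎-↔_)
open import Data.Unit using (⊤; tt)
open import Data.Vec as Vec using (Vec; []; _∷_; zipWith)
open import Data.Vec.Properties using (lookup∘tabulate)
open import Function using (_∘_; id)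
open import Function.Bundles using (_↔_; mk↔ₛ′; Inverse)
open import Function.Construct.Composition using (_↔-∘_)
open import Function.Construct.Symmetry using (↔-sym)
open import Relation.Binary.PropositionalEquality
open import Relation.Nullary using (Dec; yes; no; does; ¬_; contradiction)
open import Relation.Nullary.Decidable using (dec-true; dec-false)

private variable
  A B : Set

_≟ʷ_ : (v w : Word) → Dec (v ≡ w)
_≟ʷ_ = ≡-dec _≟ᵇ_

-- Decision trees

-- A run on a fixed input depends on the oracle only through the answers, so its courses under all
-- oracles form one finite binary tree; the first subtree follows a yes.
data Tree (A : Set) : Set where
  leaf : A → Tree A
  node : Word → Tree A → Tree A → Tree A

node-cong : ∀ {q q′} {t t′ f f′ : Tree A} →
  q ≡ q′ → t ≡ t′ → f ≡ f′ → node q t f ≡ node q′ t′ f′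
node-cong refl refl refl = refl

answer : Language → Tree A → A
answer X (leaf a)     = a
answer X (node q t f) = if X q then answer X t else answer X f

asks : Language → Tree A → List Word
asks X (leaf a)     = []
asks X (node q t f) = q ∷ (if X q then asks X t else asks X f)

depth : Tree A → ℕ
depth (leaf a)     = 0
depth (node q t f) = suc (depth t ⊔ depth f)

length-asks : ∀ X (t : Tree A) → length (asks X t) ≤ depth t
length-asks X (leaf a) = z≤n
length-asks X (node q t f) with X q
... | true  = s≤s (≤-trans (length-asks X t) (m≤m⊔n _ _))
... | false = s≤s (≤-trans (length-asks X f) (m≤n⊔m _ _))

-- Only the path taken under `X` matters: agreement at each of its nodes sends `Y` along the same
-- branch.
asks-answer-agree : ∀ {X Y} (t : Tree A) → All (λ q → X q ≡ Y q) (asks X t) →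
  asks Y t ≡ asks X t × answer Y t ≡ answer X t
asks-answer-agree (leaf a) h = refl , refl
asks-answer-agree {X = X} (node q t f) (e ∷ h) rewrite sym e with X q
... | true  = let (a , b) = asks-answer-agree t h in cong (q ∷_) a , b
... | false = let (a , b) = asks-answer-agree f h in cong (q ∷_) a , b

-- A tree that asks for z before any shorter word cannot learn about z from
-- an oracle that differs from D only at z and at shorter words.
asks-avoid : ∀ {X D z} (t : Tree A) →
  (∀ q → length z ≤ length q → q ≢ z → X q ≡ D q) →
  AllPairs _≥_ (map length (asks X t)) → z ∉ asks D t → z ∉ asks X t
asks-avoid (leaf a) agree mono z∉ ()
asks-avoid (node q t f) agree mono z∉ (here z≡q) = z∉ (here z≡q)
asks-avoid {X = X} {D} {z} (node q t f) agree (q≥ ∷ mono) z∉ (there z∈)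
  with q ≟ʷ z
... | yes q≡z = z∉ (here (sym q≡z))
-- As `z` is asked further down, `q` is at least as long as `z`, so `X` and `D` branch the same way
-- here.
... | no  q≢z with agree q (All.lookup q≥ (∈-map⁺ length z∈)) q≢z
...   | Xq≡Dq with X q | D q | Xq≡Dq
...     | true  | true  | _ = asks-avoid t agree mono (z∉ ∘ there) z∈
...     | false | false | _ = asks-avoid f agree mono (z∉ ∘ there) z∈

-- Runs as decision trees

module _ (M : OracleTM) where
  open OracleTM M renaming (yes to yesState; no to noState)
  open Computation M

  -- When the time runs out the leaf holds the current state, halted or not, so every pair of a
  -- machine and a time bound yields a tree.
  tree : ℕ → State states → Vec (Tape auxSymbols) tapes → Tree (State states)
  tree zero    s            ts = leaf s
  tree (suc T) (ordinary q) ts =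
    let r = δ q (Vec.map head ts) in tree T (proj₁ r) (zipWith act ts (proj₂ r))
  tree (suc T) query        ts =
    node (word (Vec.head ts)) (tree T (ordinary yesState) ts) (tree T (ordinary noState) ts)
  tree (suc T) accept       ts = tree T accept ts
  tree (suc T) reject       ts = tree T reject ts

  runTree : ℕ → Word → Tree (State states)
  runTree T x = tree T (ordinary start) (contents (initial x))

  answer-tree : ∀ X T s ts → state (run X T (config s ts)) ≡ answer X (tree T s ts)
  answer-tree X zero    s            ts = refl
  answer-tree X (suc T) (ordinary q) ts = answer-tree X T _ _
  answer-tree X (suc T) query        ts with X (word (Vec.head ts))
  ... | true  = answer-tree X T _ ts
  ... | false = answer-tree X T _ ts
  answer-tree X (suc T) accept       ts = answer-tree X T accept ts
  answer-tree X (suc T) reject       ts = answer-tree X T reject ts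

  asks-tree : ∀ X T s ts → queries X T (config s ts) ≡ asks X (tree T s ts)
  asks-tree X zero    s            ts = refl
  asks-tree X (suc T) (ordinary q) ts = asks-tree X T _ _
  asks-tree X (suc T) query        ts with X (word (Vec.head ts))
  ... | true  = cong (_ ∷_) (asks-tree X T _ ts)
  ... | false = cong (_ ∷_) (asks-tree X T _ ts)
  asks-tree X (suc T) accept       ts = asks-tree X T accept ts
  asks-tree X (suc T) reject       ts = asks-tree X T reject ts

  answer-runTree : ∀ X T x → state (run X T (initial x)) ≡ answer X (runTree T x)
  answer-runTree X T x = answer-tree X T (ordinary start) (contents (initial x))

  asks-runTree : ∀ X T x → queries X T (initial x) ≡ asks X (runTree T x)
  asks-runTree X T x = asks-tree X T (ordinary start) (contents (initial x))

  depth-tree : ∀ T s ts → depth (tree T s ts) ≤ T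
  depth-tree zero    s            ts = z≤n
  depth-tree (suc T) (ordinary q) ts = m≤n⇒m≤1+n (depth-tree T _ _)
  depth-tree (suc T) query        ts = s≤s (⊔-lub (depth-tree T _ ts) (depth-tree T _ ts))
  depth-tree (suc T) accept       ts = m≤n⇒m≤1+n (depth-tree T accept ts)
  depth-tree (suc T) reject       ts = m≤n⇒m≤1+n (depth-tree T reject ts)

  Transition : Set
  Transition = Fin states → Vec (Symbol auxSymbols) tapes →
    State states × Vec (Symbol auxSymbols × Move) tapes

  replaceδ : Transition → OracleTM
  replaceδ δ′ = record
    { states = states ; auxSymbols = auxSymbols ; extraTapes = extraTapes
    ; start = start ; yes = yesState ; no = noState ; δ = δ′ }

module _ (M : OracleTM) (δ′ : Transition M)
  (same : ∀ q v → δ′ q v ≡ OracleTM.δ M q v) where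

  -- A transition function rebuilt from its table equals the original only pointwise, so machines
  -- are compared by their trees.
  tree-replaceδ : ∀ T s ts → tree (replaceδ M δ′) T s ts ≡ tree M T s ts
  tree-replaceδ zero    s            ts = refl
  tree-replaceδ (suc T) (ordinary q) ts rewrite same q (Vec.map head ts) =
    tree-replaceδ T _ _
  tree-replaceδ (suc T) query        ts =
    node-cong refl (tree-replaceδ T _ ts) (tree-replaceδ T _ ts)
  tree-replaceδ (suc T) accept       ts = tree-replaceδ T accept ts
  tree-replaceδ (suc T) reject       ts = tree-replaceδ T reject ts

-- Countability of the set of machines

Finite : Set → Set
Finite A = ∃[ n ] A ↔ Fin n

size : Finite A → ℕ
size = proj₁

toFin : (fin : Finite A) → A → Fin (size fin)
toFin (_ , i) = Inverse.to i

fromFin : (fin : Finite A) → Fin (size fin) → A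
fromFin (_ , i) = Inverse.from i

fromFin-toFin : (fin : Finite A) (a : A) → fromFin fin (toFin fin a) ≡ a
fromFin-toFin (_ , i) = Inverse.strictlyInverseʳ i

finite-↔ : A ↔ B → Finite B → Finite A
finite-↔ i (n , j) = n , (j ↔-∘ i)

finite-⊤ : Finite ⊤
finite-⊤ = 1 , ↔-sym 1↔⊤

finite-Bool : Finite Bool
finite-Bool = 2 , ↔-sym 2↔Bool

finite-Fin : ∀ n → Finite (Fin n)
finite-Fin n = n , mk↔ₛ′ id id (λ _ → refl) (λ _ → refl)

finite-× : Finite A → Finite B → Finite (A × B)
finite-× (m , i) (n , j) = m * n , (↔-sym *↔× ↔-∘ (i ×-↔ j))

finite-⊎ : Finite A → Finite B → Finite (A ⊎ B)
finite-⊎ (m , i) (n , j) = m + n , (↔-sym +↔⊎ ↔-∘ (i ⊎-↔ j))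

finite-Vec : ∀ n → Finite A → Finite (Vec A n)
finite-Vec zero    fin = finite-↔
  (mk↔ₛ′ (λ _ → tt) (λ _ → []) (λ _ → refl) (λ { [] → refl })) finite-⊤
finite-Vec (suc n) fin = finite-↔
  (mk↔ₛ′ Vec.uncons (λ (a , as) → a ∷ as)
    (λ _ → refl) (λ { (_ ∷ _) → refl }))
  (finite-× fin (finite-Vec n fin))

finite-Symbol : ∀ m → Finite (Symbol m)
finite-Symbol m = finite-↔
  (mk↔ₛ′
    (λ { blank → inj₁ tt ; (bit b) → inj₂ (inj₁ b) ; (aux i) → inj₂ (inj₂ i) })
    (λ { (inj₁ _) → blank ; (inj₂ (inj₁ b)) → bit b ; (inj₂ (inj₂ i)) → aux i })
    (λ { (inj₁ _) → refl ; (inj₂ (inj₁ _)) → refl ; (inj₂ (inj₂ _)) → refl })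
    (λ { blank → refl ; (bit _) → refl ; (aux _) → refl }))
  (finite-⊎ finite-⊤ (finite-⊎ finite-Bool (finite-Fin m)))

finite-Move : Finite Move
finite-Move = 3 , mk↔ₛ′
  (λ { left → 0F ; stay → 1F ; right → 2F })
  (λ { 0F → left ; 1F → stay ; 2F → right })
  (λ { 0F → refl ; 1F → refl ; 2F → refl })
  (λ { left → refl ; stay → refl ; right → refl })

finite-State : ∀ n → Finite (State n)
finite-State n = finite-↔
  (mk↔ₛ′
    (λ { (ordinary q) → inj₁ q ; query → inj₂ 0F ; accept → inj₂ 1F ; reject → inj₂ 2F })
    (λ { (inj₁ q) → ordinary q ; (inj₂ 0F) → query ; (inj₂ 1F) → accept ; (inj₂ 2F) → reject })
    (λ { (inj₁ _) → refl ; (inj₂ 0F) → refl ; (inj₂ 1F) → refl ; (inj₂ 2F) → refl })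
    (λ { (ordinary _) → refl ; query → refl ; accept → refl ; reject → refl }))
  (finite-⊎ (finite-Fin n) (finite-Fin 3))

-- The diagonals of ℕ × ℕ, each walked from (s , 0) to (0 , s).
unpair : ℕ → ℕ × ℕ
unpair zero    = 0 , 0
unpair (suc n) with unpair n
... | zero  , b = suc b , 0
... | suc a , b = a , suc b

unpair-onto : ∀ a b → ∃[ n ] unpair n ≡ (a , b)
unpair-onto a b = onDiagonal (a + b) b a refl
  where
  onDiagonal : ∀ s b a → a + b ≡ s → ∃[ n ] unpair n ≡ (a , b)
  onDiagonal s       zero    zero    _ = 0 , refl
  -- The first pair of a diagonal follows the last pair (0 , s) of the preceding one.
  onDiagonal (suc s) zero    (suc a) e with onDiagonal s s 0 refl
  ... | n , en = suc n , lemma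
    where
    lemma : unpair (suc n) ≡ (suc a , 0)
    lemma rewrite en = cong (_, 0) (trans (sym e) (+-identityʳ (suc a)))
  onDiagonal s       (suc b) a       e with onDiagonal s b (suc a) (trans (sym (+-suc a b)) e)
  ... | n , en = suc n , lemma
    where
    lemma : unpair (suc n) ≡ (a , suc b)
    lemma rewrite en = refl

-- Partial enumerations, so that empty types are included.
record Countable (A : Set) : Set where
  constructor countable
  field
    enumerate : ℕ → Maybe A
    complete  : ∀ a → ∃[ n ] enumerate n ≡ just a

open Countable

countable-ℕ : Countable ℕ
countable-ℕ = countable just (λ n → n , refl)

countable-Fin : ∀ n → Countable (Fin n)
countable-Fin n = countable decode (λ i → toℕ i , decode-toℕ i)
  where
  decode : ℕ → Maybe (Fin n)
  decode i with i <? n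
  ... | yes i<n = just (fromℕ< i<n)
  ... | no  _   = nothing

  decode-toℕ : ∀ i → decode (toℕ i) ≡ just i
  decode-toℕ i with toℕ i <? n
  ... | yes i<n = cong just (fromℕ<-toℕ i i<n)
  ... | no  i≮n = contradiction (toℕ<n i) i≮n

countable-image : (f : A → B) → (∀ b → ∃[ a ] f a ≡ b) → Countable A → Countable B
countable-image f onto c = countable (Maybe.map f ∘ enumerate c) λ b →
  let (a , fa≡b) = onto b
      (n , en)   = complete c a
  in n , trans (cong (Maybe.map f) en) (cong just fa≡b)

countable-Finite : Finite A → Countable A
countable-Finite fin = countable-image (fromFin fin)
  (λ a → toFin fin a , fromFin-toFin fin a) (countable-Fin (size fin))

countable-Σ : {B : A → Set} → Countable A → (∀ a → Countable (B a)) → Countable (Σ A B)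
countable-Σ {A} {B} cA cB = countable decode (λ (a , b) → code a b)
  where
  decode : ℕ → Maybe (Σ A B)
  decode n = let (i , j) = unpair n in
    enumerate cA i >>= λ a → enumerate (cB a) j >>= λ b → just (a , b)

  code : ∀ a b → ∃[ n ] decode n ≡ just (a , b)
  code a b with complete cA a | complete (cB a) b
  ... | i , ei | j , ej with unpair-onto i j
  ...   | n , en = n , lemma
    where
    lemma : decode n ≡ just (a , b)
    lemma rewrite en | ei | ej = refl

countable-× : Countable A → Countable B → Countable (A × B)
countable-× cA cB = countable-Σ cA (λ _ → cB)

countable-Vec : ∀ n → Countable A → Countable (Vec A n)
countable-Vec zero    c = countable (λ _ → just []) (λ { [] → 0 , refl })
countable-Vec (suc n) c = countable-image (λ (a , as) → a ∷ as)
  (λ { (a ∷ as) → (a , as) , refl }) (countable-× c (countable-Vec n c))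

countable-List : Countable A → Countable (List A)
countable-List c = countable-image (λ v → Vec.toList (proj₂ v)) onto
  (countable-Σ countable-ℕ (λ n → countable-Vec n c))
  where
  onto : ∀ as → Σ (Σ ℕ (Vec _)) λ v → Vec.toList (proj₂ v) ≡ as
  onto []       = (0 , []) , refl
  onto (a ∷ as) with onto as
  ... | (n , v) , e = (suc n , a ∷ v) , cong (a ∷_) e

-- Codes for machines

finite-δ-domain : ∀ s m t → Finite (Fin s × Vec (Symbol m) (2 + t))
finite-δ-domain s m t = finite-× (finite-Fin s) (finite-Vec (2 + t) (finite-Symbol m))

finite-δ-codomain : ∀ s m t → Finite (State s × Vec (Symbol m × Move) (2 + t))
finite-δ-codomain s m t =
  finite-× (finite-State s) (finite-Vec (2 + t) (finite-× (finite-Symbol m) finite-Move))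

-- The transition function is stored as the table of its values on the numbered finite domain, which
-- turns a machine into finite data.
MachineCode : Set
MachineCode = Σ (ℕ × ℕ × ℕ) λ (s , m , t) → (Fin s × Fin s × Fin s) ×
  Vec (State s × Vec (Symbol m × Move) (2 + t)) (size (finite-δ-domain s m t))

countable-MachineCode : Countable MachineCode
countable-MachineCode =
  countable-Σ (countable-× countable-ℕ (countable-× countable-ℕ countable-ℕ)) λ (s , m , t) →
    countable-Finite (finite-×
      (finite-× (finite-Fin s) (finite-× (finite-Fin s) (finite-Fin s)))
      (finite-Vec (size (finite-δ-domain s m t)) (finite-δ-codomain s m t)))

decodeMachine : MachineCode → OracleTM
decodeMachine ((s , m , t) , (q₀ , q₁ , q₂) , table) = record
  { states = s ; auxSymbols = m ; extraTapes = t ; start = q₀ ; yes = q₁ ; no = q₂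
  ; δ = λ q v → Vec.lookup table (toFin (finite-δ-domain s m t) (q , v)) }

abstract
  countable-Machines : Countable (MachineCode × Polynomial)
  countable-Machines = countable-× countable-MachineCode (countable-List countable-ℕ)

-- The quantifier hides how many states the decoded machine has, so the trees are compared through
-- acceptance and queries, whose types do not mention states.
decodeMachine-onto : ∀ M → ∃[ c ] ∀ T x X →
  isAccept (answer X (runTree (decodeMachine c) T x)) ≡ isAccept (answer X (runTree M T x)) ×
  asks X (runTree (decodeMachine c) T x) ≡ asks X (runTree M T x)
decodeMachine-onto M = code , λ T x X →
  let e = tree-replaceδ M δ′ same T _ _ in
  cong (isAccept ∘ answer X) e , cong (asks X) e
  where
  open OracleTM M using (states; auxSymbols; extraTapes; tapes; start; δ)
  dom = finite-δ-domain states auxSymbols extraTapes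

  value : Fin states × Vec (Symbol auxSymbols) tapes →
    State states × Vec (Symbol auxSymbols × Move) tapes
  value (q , v) = δ q v

  table = Vec.tabulate (λ i → value (fromFin dom i))

  code : MachineCode
  code = _ , (start , OracleTM.yes M , OracleTM.no M) , table

  δ′ : Transition M
  δ′ q v = Vec.lookup table (toFin dom (q , v))

  same : ∀ q v → δ′ q v ≡ δ q v
  same q v = trans (lookup∘tabulate _ (toFin dom (q , v)))
                   (cong value (fromFin-toFin dom (q , v)))

-- The increasing machine

-- In state 0F the input is copied to the oracle tape.  In the states 1F and 2F,
-- entered after the answers yes and no, that answer is appended to the oracle
-- word and the last input symbol is erased, so that the input tape counts down
-- the queries.
walker : OracleTM
walker = record
  { states = 3 ; auxSymbols = 0 ; extraTapes = 0
  ; start = 0F ; yes = 1F ; no = 2F ; δ = transition }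
  where
  extend : Bool → Symbol 0 → State 3 × Vec (Symbol 0 × Move) 2
  extend b (bit _) = query , (bit b , right) ∷ (blank , left) ∷ []
  -- The input tape is blank under the head once all |x| symbols are erased, hence after |x|
  -- queries; the last answer becomes the verdict.
  extend b _       = (if b then accept else reject) , (blank , stay) ∷ (blank , stay) ∷ []

  copy : Symbol 0 → State 3 × Vec (Symbol 0 × Move) 2
  copy (bit c) = ordinary 0F , (bit c , right) ∷ (bit c , right) ∷ []
  -- The end of the input acts like an answer yes, which makes x1 the first query.
  copy _       = ordinary 1F , (blank , stay) ∷ (blank , left) ∷ []

  transition : Fin 3 → Vec (Symbol 0) 2 → State 3 × Vec (Symbol 0 × Move) 2
  transition 0F (_ ∷ s ∷ []) = copy s
  transition 1F (_ ∷ s ∷ []) = extend true s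
  transition 2F (_ ∷ s ∷ []) = extend false s

-- The last answer is b, and v is the current oracle word in reverse.
walk : ℕ → Bool → Word → Tree (State 3)
walk zero    b v = leaf (if b then accept else reject)
walk (suc k) b v = node (reverse (b ∷ v)) (walk k true (b ∷ v)) (walk k false (b ∷ v))

-- Tape contents of the increasing machine

bits : Word → List (Symbol 0)
bits = map bit

reading : List (Symbol 0) → List (Symbol 0) → Tape 0
reading ls []       = tape ls blank []
reading ls (r ∷ rs) = tape ls r rs

tapeOf-reading : ∀ ss → tapeOf ss ≡ reading [] ss
tapeOf-reading []       = refl
tapeOf-reading (s ∷ ss) = refl

move-right-reading : ∀ ls s rs → move right (tape ls s rs) ≡ reading (s ∷ ls) rs
move-right-reading ls s []       = refl
move-right-reading ls s (r ∷ rs) = refl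

-- The input tape during the countdown: the remaining symbols are listed last first, with the head
-- on the first of that list, or on a blank first cell if none remain.
erasing : List (Symbol 0) → List (Symbol 0) → Tape 0
erasing []       rs = tape [] blank rs
erasing (l ∷ ls) rs = tape ls l rs

-- Cells to the right of the head are not visited again, so their contents are left existential.
move-left-erasing : ∀ ls rs → ∃[ rs′ ] move left (tape ls blank rs) ≡ erasing ls rs′
move-left-erasing []       rs = rs , refl
move-left-erasing (l ∷ ls) rs = blank ∷ rs , refl

leadingBits-bits : ∀ w → leadingBits (bits w ++ blank ∷ []) ≡ w
leadingBits-bits []      = refl
leadingBits-bits (b ∷ w) = cong (b ∷_) (leadingBits-bits w)

bits-ʳ++ : ∀ v w ss → bits v ʳ++ (bits w ++ ss) ≡ bits (v ʳ++ w) ++ ss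
bits-ʳ++ []      w ss = refl
bits-ʳ++ (b ∷ v) w ss = bits-ʳ++ v (b ∷ w) ss

word-bits : ∀ v → word (tape (bits v) blank []) ≡ reverse v
word-bits v = trans (cong leadingBits (bits-ʳ++ v [] (blank ∷ []))) (leadingBits-bits (reverse v))

tree-copying : ∀ T w v →
  tree walker (length w + T) (ordinary 0F)
    (tape (bits v) blank [] ∷ reading (bits v) (bits w) ∷ []) ≡
  tree walker T (ordinary 0F)
    (tape (bits (w ʳ++ v)) blank [] ∷ tape (bits (w ʳ++ v)) blank [] ∷ [])
tree-copying T []      v = refl
tree-copying T (c ∷ w) v rewrite move-right-reading (bits v) (bit c) (bits w) =
  tree-copying T w (c ∷ v)

afterAnswer : Bool → Fin 3
afterAnswer true  = 1F
afterAnswer false = 2F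

-- Each remaining input symbol costs two steps, one to extend the oracle word and one to query; a
-- last step gives the verdict.
tree-walking : ∀ y b v rs →
  tree walker (length y * 2 + 1) (ordinary (afterAnswer b))
    (tape (bits v) blank [] ∷ erasing (bits y) rs ∷ []) ≡
  walk (length y) b v
tree-walking []      true  v rs = refl
tree-walking []      false v rs = refl
tree-walking (c ∷ y) true  v rs with move-left-erasing (bits y) rs
... | rs′ , e rewrite e = node-cong (word-bits (true ∷ v))
  (tree-walking y true (true ∷ v) rs′) (tree-walking y false (true ∷ v) rs′)
tree-walking (c ∷ y) false v rs with move-left-erasing (bits y) rs
... | rs′ , e rewrite e = node-cong (word-bits (false ∷ v))
  (tree-walking y true (false ∷ v) rs′) (tree-walking y false (false ∷ v) rs′)

-- 2 + 3n: n steps of copying, one to turn back, 2n for the queries and one to halt.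
walkerBound : Polynomial
walkerBound = 2 ∷ 3 ∷ []

eval-walkerBound : ∀ n → eval walkerBound n ≡ n + (1 + (n * 2 + 1))
eval-walkerBound = expand
  where
  expand : ∀ n → 2 + n * (3 + n * 0) ≡ n + (1 + (n * 2 + 1))
  expand = solve-∀

runTree-walker : ∀ x →
  runTree walker (eval walkerBound (length x)) x ≡ walk (length x) true (reverse x)
runTree-walker x = begin
  runTree walker (eval walkerBound n) x
    ≡⟨ cong₂ (λ T input → tree walker T (ordinary 0F) (tape [] blank [] ∷ input ∷ []))
         (eval-walkerBound n) (tapeOf-reading (bits x)) ⟩
  tree walker (n + (1 + (n * 2 + 1))) (ordinary 0F)
    (tape [] blank [] ∷ reading [] (bits x) ∷ [])
    ≡⟨ tree-copying (1 + (n * 2 + 1)) x [] ⟩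
  tree walker (n * 2 + 1) (ordinary 1F)
    (tape (bits x⁻) blank [] ∷ move left (tape (bits x⁻) blank []) ∷ [])
    ≡⟨ cong₂ (λ k input → tree walker (k * 2 + 1) (ordinary 1F)
           (tape (bits x⁻) blank [] ∷ input ∷ []))
         (sym (length-reverse x)) (proj₂ (move-left-erasing (bits x⁻) [])) ⟩
  tree walker (length x⁻ * 2 + 1) (ordinary 1F)
    (tape (bits x⁻) blank [] ∷ erasing (bits x⁻) _ ∷ [])
    ≡⟨ tree-walking x⁻ true x⁻ _ ⟩
  walk (length x⁻) true x⁻
    ≡⟨ cong (λ k → walk k true x⁻) (length-reverse x) ⟩
  walk n true x⁻ ∎
  where
  open ≡-Reasoning
  n = length x
  x⁻ = reverse x

-- Queries and output of the increasing machine

halted-walk : ∀ X k b v → Halted (answer X (walk k b v))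
halted-walk X zero    true  v = accepted
halted-walk X zero    false v = rejected
halted-walk X (suc k) b     v with X (reverse (b ∷ v))
... | true  = halted-walk X k true (b ∷ v)
... | false = halted-walk X k false (b ∷ v)

linked-walk : ∀ X k b v → Linked _<_ (length v ∷ map length (asks X (walk k b v)))
linked-walk X zero    b v = [-]
linked-walk X (suc k) b v rewrite length-reverse (b ∷ v) with X (reverse (b ∷ v))
... | true  = ≤-refl ∷ linked-walk X k true (b ∷ v)
... | false = ≤-refl ∷ linked-walk X k false (b ∷ v)

state-walker : ∀ X x → let open Computation walker in
  state (run X (eval walkerBound (length x)) (initial x)) ≡
  answer X (walk (length x) true (reverse x))
state-walker X x = trans (answer-runTree walker X (eval walkerBound (length x)) x)
  (cong (answer X) (runTree-walker x))

walkerDPTM : DPTM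
walkerDPTM = record
  { machine = walker
  ; bound   = walkerBound
  ; halts   = λ X x → subst Halted (sym (state-walker X x)) (halted-walk X (length x) true (reverse x))
  }

linked-walker : ∀ X x → Linked _<_ (length x ∷ map length (DPTM.querySequence walkerDPTM X x))
linked-walker X x =
  subst (λ qs → Linked _<_ (length x ∷ map length qs))
    (sym (trans (asks-runTree walker X (eval walkerBound (length x)) x)
                (cong (asks X) (runTree-walker x))))
    (subst (λ l → Linked _<_ (l ∷ map length (asks X (walk (length x) true (reverse x)))))
      (length-reverse x) (linked-walk X (length x) true (reverse x)))

-- The next query is the prefix of `z` that ends in `b`. If `u` is nonempty, the hint makes the
-- answer the next symbol of `z` and the invariant persists; if `u` is empty, the query is `z`
-- itself and its answer is the verdict.
answer-walk : ∀ {X z} u b v → v ʳ++ (b ∷ u) ≡ z →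
  (∀ w c s → w ++ c ∷ s ≡ z → length v < length w → X w ≡ c) →
  isAccept (answer X (walk (suc (length u)) b v)) ≡ X z
answer-walk {X} []      b v refl hint with X (reverse (b ∷ v))
... | true  = refl
... | false = refl
answer-walk {X} (c ∷ u) b v e hint
  rewrite hint (reverse (b ∷ v)) c u (trans (sym (ʳ++-defn (b ∷ v))) e)
            (≤-reflexive (sym (length-reverse (b ∷ v))))
  with c
... | true  = answer-walk u true (b ∷ v) e (λ w d s e′ l → hint w d s e′ (<-trans (n<1+n _) l))
... | false = answer-walk u false (b ∷ v) e (λ w d s e′ l → hint w d s e′ (<-trans (n<1+n _) l))

-- Diagonalization

n<2^n : ∀ n → n < 2 ^ n
n<2^n zero    = s≤s z≤n
n<2^n (suc n) = begin
  suc (suc n)     ≤⟨ s≤s (m≤n+m (suc n) n) ⟩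
  suc n + suc n   ≤⟨ +-mono-≤ (n<2^n n) (≤-trans (n<2^n n) (m≤m+n _ 0)) ⟩
  2 ^ suc n       ∎
  where open ≤-Reasoning

-- A Horner step with coefficient `a` multiplies the bound by at most 2^a times 2^j, so the exponent
-- gains `a` and `j` for each coefficient.
eval<2^ : ∀ p j → eval p (2 ^ j) < 2 ^ (sum p + j * length p)
eval<2^ []      j rewrite *-zeroʳ j = ≤-refl
eval<2^ (a ∷ p) j = begin
  suc a + 2 ^ j * eval p (2 ^ j)
    ≤⟨ +-mono-≤ (m≤m*n (suc a) (2 ^ j) {{m^n≢0 2 j}})
                (m≤n*m (2 ^ j * eval p (2 ^ j)) (suc a)) ⟩
  suc a * 2 ^ j + suc a * (2 ^ j * eval p (2 ^ j))
    ≡⟨ factor (suc a) (2 ^ j) (eval p (2 ^ j)) ⟩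
  suc a * (2 ^ j * suc (eval p (2 ^ j)))
    ≤⟨ *-mono-≤ (n<2^n a) (*-monoʳ-≤ (2 ^ j) (eval<2^ p j)) ⟩
  2 ^ a * (2 ^ j * 2 ^ (sum p + j * length p))
    ≡⟨ cong (2 ^ a *_) (^-distribˡ-+-* 2 j _) ⟨
  2 ^ a * 2 ^ (j + (sum p + j * length p))
    ≡⟨ ^-distribˡ-+-* 2 a _ ⟨
  2 ^ (a + (j + (sum p + j * length p)))
    ≡⟨ cong (2 ^_) (exponent a j (sum p) (length p)) ⟩
  2 ^ (sum (a ∷ p) + j * length (a ∷ p)) ∎
  where
  open ≤-Reasoning
  factor : ∀ a y e → a * y + a * (y * e) ≡ a * (y * (1 + e))
  factor = solve-∀
  exponent : ∀ a j s d → a + (j + (s + j * d)) ≡ (a + s) + j * (1 + d)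
  exponent = solve-∀

abstract
  -- The argument is suc k = 2 ^ (a + a), whose logarithm a + a is linear in the
  -- parameters while suc k exceeds the quadratic (suc a) * (suc a).
  eval<2^-large : ∀ p m → ∃[ k ] m ≤ k × eval p (suc k) < 2 ^ k
  eval<2^-large p m = pred n , <⇒≤pred m<n , eval<
    where
    open ≤-Reasoning
    s d a n : ℕ
    s = sum p
    d = length p
    -- Chosen to dominate `m`, `s` and 2d separately, as `m<n` and `exponent<n` require.
    a = m + s + (d + d)
    n = 2 ^ (a + a)

    suc-pred-n : suc (pred n) ≡ n
    suc-pred-n = suc-pred n {{m^n≢0 2 (a + a)}}

    square≤n : suc a * suc a ≤ n
    square≤n = begin
      suc a * suc a  ≤⟨ *-mono-≤ (n<2^n a) (n<2^n a) ⟩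
      2 ^ a * 2 ^ a  ≡⟨ ^-distribˡ-+-* 2 a a ⟨
      n              ∎

    m<n : m < n
    m<n = begin-strict
      m              ≤⟨ ≤-trans (m≤m+n m s) (m≤m+n (m + s) (d + d)) ⟩
      a              <⟨ m≤m*n (suc a) (suc a) ⟩
      suc a * suc a  ≤⟨ square≤n ⟩
      n              ∎

    exponent<n : s + (a + a) * d < n
    exponent<n = begin-strict
      s + (a + a) * d      ≡⟨ cong (s +_) (double a d) ⟩
      s + a * (d + d)      ≤⟨ +-mono-≤ (≤-trans (m≤n+m s m) (m≤m+n (m + s) (d + d)))
                                         (*-monoʳ-≤ a (m≤n+m (d + d) (m + s))) ⟩
      a + a * a            <⟨ s≤s (m≤n+m (a + a * a) a) ⟩
      suc (a + (a + a * a)) ≡⟨ square a ⟩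
      suc a * suc a        ≤⟨ square≤n ⟩
      n                    ∎
      where
      double : ∀ a d → (a + a) * d ≡ a * (d + d)
      double = solve-∀
      square : ∀ a → 1 + (a + (a + a * a)) ≡ (1 + a) * (1 + a)
      square = solve-∀

    eval< : eval p (suc (pred n)) < 2 ^ pred n
    eval< = begin-strict
      eval p (suc (pred n))   ≡⟨ cong (eval p) suc-pred-n ⟩
      eval p n                <⟨ eval<2^ p (a + a) ⟩
      2 ^ (s + (a + a) * d)   ≤⟨ ^-monoʳ-≤ 2 (<⇒≤pred exponent<n) ⟩
      2 ^ pred n              ∎

-- Words missing from a short list

tailsAfter : Bool → List Word → List Word
tailsAfter b []             = []
tailsAfter b ([] ∷ Q)       = tailsAfter b Q
tailsAfter true  ((true  ∷ w) ∷ Q) = w ∷ tailsAfter true Q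
tailsAfter true  ((false ∷ w) ∷ Q) = tailsAfter true Q
tailsAfter false ((true  ∷ w) ∷ Q) = tailsAfter false Q
tailsAfter false ((false ∷ w) ∷ Q) = w ∷ tailsAfter false Q

∈-tailsAfter : ∀ b {w Q} → b ∷ w ∈ Q → w ∈ tailsAfter b Q
∈-tailsAfter true  {Q = (true  ∷ _) ∷ Q} (here refl) = here refl
∈-tailsAfter false {Q = (false ∷ _) ∷ Q} (here refl) = here refl
∈-tailsAfter b     {Q = []          ∷ Q} (there i) = ∈-tailsAfter b i
∈-tailsAfter true  {Q = (true  ∷ _) ∷ Q} (there i) = there (∈-tailsAfter true i)
∈-tailsAfter true  {Q = (false ∷ _) ∷ Q} (there i) = ∈-tailsAfter true i
∈-tailsAfter false {Q = (true  ∷ _) ∷ Q} (there i) = ∈-tailsAfter false i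
∈-tailsAfter false {Q = (false ∷ _) ∷ Q} (there i) = there (∈-tailsAfter false i)

length-tailsAfter : ∀ Q → length (tailsAfter true Q) + length (tailsAfter false Q) ≤ length Q
length-tailsAfter []                = z≤n
length-tailsAfter ([] ∷ Q)          = m≤n⇒m≤1+n (length-tailsAfter Q)
length-tailsAfter ((true ∷ w) ∷ Q)  = s≤s (length-tailsAfter Q)
length-tailsAfter ((false ∷ w) ∷ Q)
  rewrite +-suc (length (tailsAfter true Q)) (length (tailsAfter false Q)) =
  s≤s (length-tailsAfter Q)

-- Pigeonhole by halving: the entries starting with true and those starting with false cannot both
-- number 2^k or more, so some first symbol leaves a list short enough for the induction.
unlisted : ∀ k (Q : List Word) → length Q < 2 ^ k → Σ Word λ u → length u ≡ k × u ∉ Q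
unlisted zero    []      _        = [] , refl , λ ()
unlisted zero    (_ ∷ _) (s≤s ())
unlisted (suc k) Q       few with length (tailsAfter true Q) <? 2 ^ k
... | yes few₁ = let (u , l , u∉) = unlisted k _ few₁ in
  true ∷ u , cong suc l , u∉ ∘ ∈-tailsAfter true
... | no  many = let (u , l , u∉) = unlisted k (tailsAfter false Q) few₀ in
  false ∷ u , cong suc l , u∉ ∘ ∈-tailsAfter false
  where
  open ≤-Reasoning
  few₀ : length (tailsAfter false Q) < 2 ^ k
  few₀ = +-cancelˡ-< (2 ^ k) _ _ (begin-strict
    2 ^ k + length (tailsAfter false Q)                         ≤⟨ +-monoˡ-≤ _ (≮⇒≥ many) ⟩
    length (tailsAfter true Q) + length (tailsAfter false Q)    ≤⟨ length-tailsAfter Q ⟩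
    length Q                                                    <⟨ few ⟩
    2 ^ k + (2 ^ k + 0)                                         ≡⟨ cong (2 ^ k +_) (+-identityʳ (2 ^ k)) ⟩
    2 ^ k + 2 ^ k                                               ∎)

drop-length-++ : ∀ (w u : Word) → drop (length w) (w ++ u) ≡ u
drop-length-++ []      u = refl
drop-length-++ (_ ∷ w) u = drop-length-++ w u

abstract
  -- Dropping |w| symbols from each entry turns a listed `w ++ u` into a listed `u`, so it suffices
  -- to avoid the shortened entries.
  unlistedExtension : ∀ (w : Word) k Q → length Q < 2 ^ k →
    Σ Word λ u → length u ≡ k × w ++ u ∉ Q
  unlistedExtension w k Q few =
    let (u , l , u∉) = unlisted k (map (drop (length w)) Q)
                         (subst (_< 2 ^ k) (sym (length-map _ Q)) few)
    in u , l , λ i → u∉ (subst (_∈ map (drop (length w)) Q) (drop-length-++ w u)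
                          (∈-map⁺ (drop (length w)) i))

-- Patched oracles

symbolAt : Word → ℕ → Bool
-- A default that `patch` never reaches, since it looks up only positions below |z|.
symbolAt []      i       = false
symbolAt (b ∷ w) zero    = b
symbolAt (b ∷ w) (suc i) = symbolAt w i

symbolAt-length : ∀ w c s → symbolAt (w ++ c ∷ s) (length w) ≡ c
symbolAt-length []      c s = refl
symbolAt-length (_ ∷ w) c s = symbolAt-length w c s

length-<-++ : ∀ (w : Word) c s → length w < length (w ++ c ∷ s)
length-<-++ []      c s = s≤s z≤n
length-<-++ (_ ∷ w) c s = s≤s (length-<-++ w c s)

-- Every word w of length between n and |z| is answered with the symbol of z at
-- position |w|, so that the answers guide the increasing machine to z.
patch : Language → ℕ → Word → Bool → Language
patch D n z b q =
  if does (length q ≤? n) then D q else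
  if does (length q <? length z) then symbolAt z (length q) else
  if does (q ≟ʷ z) then b else D q

module Patch (D : Language) (n : ℕ) (z : Word) where

  patch-short : ∀ b q → length q ≤ n → patch D n z b q ≡ D q
  patch-short b q le rewrite dec-true (length q ≤? n) le = refl

  patch-guide : ∀ b w c s → w ++ c ∷ s ≡ z → n < length w → patch D n z b w ≡ c
  patch-guide b w c s refl n<
    rewrite dec-false (length w ≤? n) (<⇒≱ n<)
          | dec-true (length w <? length z) (length-<-++ w c s) = symbolAt-length w c s

  patch-at : ∀ b → n < length z → patch D n z b z ≡ b
  patch-at b n<
    rewrite dec-false (length z ≤? n) (<⇒≱ n<)
          | dec-false (length z <? length z) (<-irrefl refl)
          | dec-true (z ≟ʷ z) refl = refl

  patch-off : ∀ b q → length z ≤ length q → q ≢ z → patch D n z b q ≡ D q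
  patch-off b q le q≢z with does (length q ≤? n)
  ... | true  = refl
  ... | false
    rewrite dec-false (length q <? length z) (≤⇒≯ le)
          | dec-false (q ≟ʷ z) q≢z = refl

  patch-irrelevant : ∀ b b′ q → q ≢ z → patch D n z b q ≡ patch D n z b′ q
  patch-irrelevant b b′ q q≢z rewrite dec-false (q ≟ʷ z) q≢z = refl

-- One stage of the construction

module Stage (M : OracleTM) (p : Polynomial) (D : Language) (m : ℕ) where

  -- `D` is the oracle so far, frozen up to length `m`. The input length exceeds `m`, and the time
  -- bound on it stays below the number 2^k of candidates for `z`.
  k = proj₁ (eval<2^-large p m)
  n = suc k

  x : Word
  x = replicate n false

  run = runTree M (eval p (length x)) x

  few : length (asks D run) < 2 ^ k
  few = begin-strict
    length (asks D run)  ≤⟨ length-asks D run ⟩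
    depth run            ≤⟨ depth-tree M (eval p (length x)) _ _ ⟩
    eval p (length x)    ≡⟨ cong (eval p) (length-replicate n) ⟩
    eval p n             <⟨ proj₂ (proj₂ (eval<2^-large p m)) ⟩
    2 ^ k                ∎
    where open ≤-Reasoning

  -- The queries to avoid are those under `D`: the patched oracle depends on `z` and is not yet
  -- available.
  fresh = unlistedExtension (x ++ true ∷ []) k (asks D run) few
  u     = proj₁ fresh

  z : Word
  z = x ++ true ∷ u

  -- The value false at `z` is a placeholder: a run that never asks `z` has the same output
  -- whichever value is put there.
  b : Bool
  b = not (isAccept (answer (patch D n z false) run))

  D′ : Language
  D′ = patch D n z b

  -- Freezing up to this length protects both `z` with its guiding prefixes and every query of the
  -- run under `D′`.
  m′ : ℕ
  m′ = max (length z) (map length (asks D′ run))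

  open Patch D n z

  z∉asksD : z ∉ asks D run
  z∉asksD = subst (_∉ asks D run) (++-assoc x (true ∷ []) u) (proj₂ (proj₂ fresh))

  n<z : n < length z
  n<z = subst (_< length z) (length-replicate n) (length-<-++ x true u)

  m<n : m < n
  m<n = s≤s (proj₁ (proj₂ (eval<2^-large p m)))

  z≤m′ : length z ≤ m′
  z≤m′ = ⊥≤max (length z) (map length (asks D′ run))

  m<m′ : m < m′
  m<m′ = <-≤-trans (<-trans m<n n<z) z≤m′

  stable : ∀ q → length q ≤ m → D′ q ≡ D q
  stable q le = patch-short b q (≤-trans le (<⇒≤ m<n))

  module _ {A : Language} (agree : ∀ q → length q ≤ m′ → A q ≡ D′ q) where

    asks-answer-A : asks A run ≡ asks D′ run × answer A run ≡ answer D′ run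
    asks-answer-A = asks-answer-agree run
      (All.map (λ {q} le → sym (agree q le))
        (All-map⁻ (xs≤max (length z) (map length (asks D′ run)))))

    walk-reaches-z : isAccept (answer A (walk (length x) true (reverse x))) ≡ b
    walk-reaches-z = begin
      isAccept (answer A (walk (length x) true (reverse x)))
        -- |x| = n = 1 + |u|, so the last query of the walk has length 2n = |z|.
        ≡⟨ cong (λ l → isAccept (answer A (walk l true (reverse x))))
             (trans (length-replicate n) (cong suc (sym (proj₁ (proj₂ fresh))))) ⟩
      isAccept (answer A (walk (suc (length u)) true (reverse x)))
        ≡⟨ answer-walk u true (reverse x) (ʳ++-ʳ++ x) guide ⟩
      A z
        ≡⟨ agree z z≤m′ ⟩
      D′ z
        ≡⟨ patch-at b n<z ⟩
      b ∎
      where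
      open ≡-Reasoning
      guide : ∀ w c s → w ++ c ∷ s ≡ z → length (reverse x) < length w → A w ≡ c
      guide w c s e l = trans
        (agree w (≤-trans (<⇒≤ (subst (length w <_) (cong length e) (length-<-++ w c s))) z≤m′))
        (patch-guide b w c s e
          (subst (_< length w) (trans (length-reverse x) (length-replicate n)) l))

    -- The run never asks `z`, so its output is the one that `b` negates, whereas the walk outputs
    -- `b`.
    diagonal : Linked _≥_ (map length (asks A run)) →
      isAccept (answer A run) ≢ isAccept (answer A (walk (length x) true (reverse x)))
    diagonal mono e = not-¬ run-unchanged (trans e walk-reaches-z)
      where
      z∉asksD′ : z ∉ asks D′ run
      -- From length |z| on, `D′` differs from `D` only at `z`. Transitivity is needed because `z`
      -- could be asked arbitrarily far below a given query.
      z∉asksD′ = asks-avoid run (patch-off b)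
        (Linked⇒AllPairs (λ i≥j j≥k → ≤-trans j≥k i≥j)
          (subst (Linked _≥_ ∘ map length) (proj₁ asks-answer-A) mono))
        z∉asksD

      run-unchanged : isAccept (answer A run) ≡ isAccept (answer (patch D n z false) run)
      run-unchanged = cong isAccept (trans (proj₂ asks-answer-A)
        (sym (proj₂ (asks-answer-agree run
          (All.tabulate λ {q} q∈ → patch-irrelevant b false q λ { refl → z∉asksD′ q∈ })))))

-- The limit of the stages

stage : Maybe (MachineCode × Polynomial) → Language × ℕ → Language × ℕ
-- Even an index without a code raises the bound, so that after e stages all words up to length e
-- are frozen.
stage nothing        (D , m) = D , suc m
stage (just (c , p)) (D , m) = D′ , m′
  where open Stage (decodeMachine c) p D m

stage-increases : ∀ c s → proj₂ s < proj₂ (stage c s)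
stage-increases nothing        (D , m) = ≤-refl
stage-increases (just (c , p)) (D , m) = Stage.m<m′ (decodeMachine c) p D m

stage-stable : ∀ c s q → length q ≤ proj₂ s → proj₁ (stage c s) q ≡ proj₁ s q
stage-stable nothing        (D , m) q le = refl
stage-stable (just (c , p)) (D , m) q le = Stage.stable (decodeMachine c) p D m q le

stages : ℕ → Language × ℕ
stages zero    = (λ _ → false) , 0
stages (suc e) = stage (enumerate countable-Machines e) (stages e)

stages-≥ : ∀ e → e ≤ proj₂ (stages e)
stages-≥ zero    = z≤n
stages-≥ (suc e) = ≤-<-trans (stages-≥ e) (stage-increases (enumerate countable-Machines e) (stages e))

stages-mono : ∀ d e → proj₂ (stages e) ≤ proj₂ (stages (d + e))
stages-mono zero    e = ≤-refl
stages-mono (suc d) e = ≤-trans (stages-mono d e) 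
  (<⇒≤ (stage-increases (enumerate countable-Machines (d + e)) (stages (d + e))))

stages-stable : ∀ d e q → length q ≤ proj₂ (stages e) →
  proj₁ (stages (d + e)) q ≡ proj₁ (stages e) q
stages-stable zero    e q le = refl
stages-stable (suc d) e q le = trans
  (stage-stable (enumerate countable-Machines (d + e)) (stages (d + e)) q
    (≤-trans le (stages-mono d e)))
  (stages-stable d e q le)

-- By stage |q| the value at `q` is frozen, so later stages give the same value.
limit : Language
limit q = proj₁ (stages (length q)) q

-- Of the stages `e` and |q|, the earlier one has already frozen `q`, so the later one keeps its
-- value.
limit-agrees : ∀ e q → length q ≤ proj₂ (stages e) → limit q ≡ proj₁ (stages e) q
limit-agrees e q le with ≤-total (length q) e
... | inj₁ l≤e = sym (subst (λ i → proj₁ (stages i) q ≡ limit q) (m∸n+n≡m l≤e)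
                   (stages-stable (e ∸ length q) (length q) q (stages-≥ (length q))))
... | inj₂ e≤l = subst (λ i → proj₁ (stages i) q ≡ proj₁ (stages e) q) (m∸n+n≡m e≤l)
                   (stages-stable (length q ∸ e) e q le)

-- The separation

module _ (M : DPTM) where
  open DPTM M

  boundedTree : Word → Tree (State states)
  boundedTree x = runTree machine (eval bound (length x)) x

  language-tree : ∀ X x → language X x ≡ isAccept (answer X (boundedTree x))
  language-tree X x = cong isAccept (answer-runTree machine X (eval bound (length x)) x)

  querySequence-tree : ∀ X x → querySequence X x ≡ asks X (boundedTree x)
  querySequence-tree X x = asks-runTree machine X (eval bound (length x)) x

walkerLanguage : Language → Language
walkerLanguage X = DPTM.language walkerDPTM X

walkerLanguage-walk : ∀ X x →
  walkerLanguage X x ≡ isAccept (answer X (walk (length x) true (reverse x)))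
walkerLanguage-walk X x = cong isAccept (state-walker X x)

walkerLanguage-s-li : ∀ X → walkerLanguage X ≤s-li-T X
walkerLanguage-s-li X = walkerDPTM , (λ x → refl) , linked-walker X

-- The stage at the index of the code and bound of `M` diagonalizes against this very run, and the
-- limit keeps the oracle of that stage up to `m′`.
not-lni : ¬ (walkerLanguage limit ≤lni-T limit)
not-lni (M , decides , nonIncreasing) = diagonal agree
  (subst (Linked _≥_ ∘ map length)
    (trans (querySequence-tree M limit x) (sym (proj₂ same))) (nonIncreasing x))
  (begin
    isAccept (answer limit run)
      ≡⟨ proj₁ same ⟩
    isAccept (answer limit (boundedTree M x))
      ≡⟨ language-tree M limit x ⟨
    DPTM.language M limit x
      ≡⟨ decides x ⟩
    walkerLanguage limit x
      ≡⟨ walkerLanguage-walk limit x ⟩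
    isAccept (answer limit (walk (length x) true (reverse x))) ∎)
  where
  open ≡-Reasoning
  c = proj₁ (decodeMachine-onto (DPTM.machine M))
  index = complete countable-Machines (c , DPTM.bound M)
  e = proj₁ index

  open Stage (decodeMachine c) (DPTM.bound M) (proj₁ (stages e)) (proj₂ (stages e))

  same = proj₂ (decodeMachine-onto (DPTM.machine M)) (eval (DPTM.bound M) (length x)) x limit

  agree : ∀ q → length q ≤ m′ → limit q ≡ D′ q
  -- Since index `e` enumerates this pair, the stage after `e` is exactly (`D′` , `m′`).
  agree = subst (λ s → ∀ q → length q ≤ proj₂ s → limit q ≡ proj₁ s q)
    (cong (λ o → stage o (stages e)) (proj₂ index)) (limit-agrees (suc e))

theorem4p11 : ∃[ A ] ∃[ B ] (B ≤s-li-T A × ¬ (B ≤lni-T A))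
theorem4p11 = limit , walkerLanguage limit
  , walkerLanguage-s-li limit
  , not-lni
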